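{- Let $n\geq 1$, let $D\in\mathfrak{S}_n$ be a permutation of $[n]=\{1,\dots,n\}$, and let $E\subset[n]$ with $|E|>1$. Suppose that $D$ has either a cycle of length greater than one containing no element of $E$, or a cycle containing at least one element of $E$ and at least one element of $[n]\setminus E$. For a cyclic permutation $\gamma$ of $[n]$ (i.e. an $n$-cycle), let $c_E(D\circ\gamma)$ denote the number of cycles of $D\circ\gamma$ that contain no element of $E$, and let $\theta(D,E)=\max_{\gamma} c_E(D\circ\gamma)$, the maximum over all cyclic permutations $\gamma$ of $[n]$. Then $$\#\{\gamma \text{ cyclic}: c_E(D\circ\gamma)=\theta(D,E)-1\}\;\geq\;\tfrac12\,\#\{\gamma\text{ cyclic}: c_E(D\circ\gamma)=\theta(D,E)\}.$$ Moreover, the constant $1/2$ is best possible: there exist $n$, $D$ and $E$ satisfying the hypotheses for which equality holds.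
   Context: Permutations are composed right to left: $(D\circ\gamma)(x)=D(\gamma(x))$. A cycle of a permutation is said to be $E$-label free if it contains no element of $E$. -}

module Defs where

open import Data.Nat using (ℕ; zero; suc; _⊔_)
open import Data.Bool using (Bool; true; false; _∧_; _∨_; not; if_then_else_)
open import Data.Fin using (Fin; zero; suc; _≟_; _≤?_)
open import Data.Fin.Subset using (Subset; _∈_)
open import Data.Product using (Σ; _×_)
open import Data.Sum using (_⊎_)
open import Relation.Nullary using (¬_)
open import Relation.Binary.PropositionalEquality using (_≡_)
open import Data.Fin.Permutation using (Permutation′; _⟨$⟩ʳ_)
open import Data.List using (List; []; _∷_; map; concatMap; allFin; filterᵇ; length; foldr)
open import Data.Bool.ListAction using (and; or)
open import Data.Vec using (lookup)
open import Relation.Nullary.Decidable using (⌊_⌋)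

allᵇ : ∀ {n} → (Fin n → Bool) → Bool
allᵇ {n} p = and (map p (allFin n))

anyᵇ : ∀ {n} → (Fin n → Bool) → Bool
anyᵇ {n} p = or (map p (allFin n))

_==_ : ∀ {n} → Fin n → Fin n → Bool
i == j = ⌊ i ≟ j ⌋

_≤ᵇ_ : ∀ {n} → Fin n → Fin n → Bool
i ≤ᵇ j = ⌊ i ≤? j ⌋

inᵇ : ∀ {n} → Fin n → Subset n → Bool
inᵇ x E = lookup E x

iter : ∀ {A : Set} → (A → A) → ℕ → A → A
iter f zero    x = x
iter f (suc k) x = f (iter f k x)

extend : ∀ {n m} → Fin m → (Fin n → Fin m) → Fin (suc n) → Fin m
extend y f zero    = y
extend y f (suc i) = f i

allFuns : ∀ n m → List (Fin n → Fin m)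
allFuns zero    m = (λ ()) ∷ []
allFuns (suc n) m = concatMap (λ f → map (λ y → extend y f) (allFin m)) (allFuns n m)

-- The k with k < n, as a list of Fin n (used to range over f⁰ x, …, f^(n-1) x,
-- which is the whole orbit of x, since orbits have size ≤ n).
orbitAll : ∀ {n} → (Fin n → Fin n) → Fin n → (Fin n → Bool) → Bool
orbitAll {n} f x p = allᵇ {n} (λ k → p (iter f (Data.Fin.toℕ k) x))

orbitAny : ∀ {n} → (Fin n → Fin n) → Fin n → (Fin n → Bool) → Bool
orbitAny {n} f x p = anyᵇ {n} (λ k → p (iter f (Data.Fin.toℕ k) x))

-- f is injective (hence a permutation of the finite set Fin n).
isPermᵇ : ∀ {n} → (Fin n → Fin n) → Bool
isPermᵇ f = allᵇ (λ i → allᵇ (λ j → not (f i == f j) ∨ (i == j)))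

isCyclicᵇ : ∀ {n} → (Fin n → Fin n) → Bool
isCyclicᵇ f = isPermᵇ f ∧ allᵇ (λ x → allᵇ (λ y → orbitAny f x (λ z → z == y)))

-- All cyclic permutations of [n] (each listed exactly once).
cyclicPerms : ∀ n → List (Fin n → Fin n)
cyclicPerms n = filterᵇ isCyclicᵇ (allFuns n n)

-- c_E(σ): the number of E-label-free cycles of the permutation σ.
-- Each cycle is counted once, via its least element x (x ≤ σ^k x for all k).
cE : ∀ {n} → Subset n → (Fin n → Fin n) → ℕ
cE {n} E σ = length (filterᵇ isRep (allFin n))
  where
  isRep : Fin n → Bool
  isRep x = orbitAll σ x (λ z → not (inᵇ z E)) ∧ orbitAll σ x (λ z → x ≤ᵇ z)

_∘ₚ_ : ∀ {n} → Permutation′ n → (Fin n → Fin n) → (Fin n → Fin n)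
(D ∘ₚ γ) x = D ⟨$⟩ʳ (γ x)

θ : ∀ {n} → Permutation′ n → Subset n → ℕ
θ {n} D E = foldr _⊔_ 0 (map (λ γ → cE E (D ∘ₚ γ)) (cyclicPerms n))

countMax : ∀ {n} → Permutation′ n → Subset n → ℕ
countMax {n} D E =
  length (filterᵇ (λ γ → ⌊ cE E (D ∘ₚ γ) Data.Nat.≟ θ D E ⌋) (cyclicPerms n))

-- #{γ cyclic : c_E(D∘γ) = θ(D,E) − 1}, written as c_E(D∘γ) + 1 = θ(D,E)
-- to avoid truncated subtraction.
countMaxMinus1 : ∀ {n} → Permutation′ n → Subset n → ℕ
countMaxMinus1 {n} D E =
  length (filterᵇ (λ γ → ⌊ suc (cE E (D ∘ₚ γ)) Data.Nat.≟ θ D E ⌋) (cyclicPerms n))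

Hyp : ∀ {n} → Permutation′ n → Subset n → Set
Hyp {n} D E =
  (Σ (Fin n) λ x → ¬ (D ⟨$⟩ʳ x ≡ x) × (∀ k → ¬ (iter (D ⟨$⟩ʳ_) k x ∈ E)))
  ⊎ (Σ (Fin n) λ x → x ∈ E × Σ ℕ λ k → ¬ (iter (D ⟨$⟩ʳ_) k x ∈ E))

{-# OPTIONS --safe #-}
module Submission where

-- Fix two labels a ≠ b in E. Let γ be a maximiser, and let c be the first
-- element of a label-free cycle of D ∘ γ met when following γ from b; suppose
-- that c comes before a. Then γ′ = γ ∘ (a b c) is again cyclic, and in D ∘ γ′
-- the cycle of c is absorbed by the cycles of a and b, so that exactly one
-- label-free cycle is lost. If c comes after a, the same works with a and b
-- exchanged, so it suffices that γ ↦ γ′ is injective on the first kind of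
-- maximisers. If γ₁ and γ₂, with c₁ ≠ c₂, had the same image, then (up to
-- symmetry) c₁ would lie in the cycle of c₂ under D ∘ γ₂; since c₂ is met first,
-- γ₁ ∘ (a b c₂) would be cyclic too, and in D ∘ γ₁ ∘ (a b c₂) one more
-- label-free cycle would be split off, against the maximality of γ₁.
-- The maximum is positive: if y ≠ D y ∉ E, a cyclic γ with γ (D y) = y makes
-- D y a fixed point of D ∘ γ.

open import Defs
open import Data.Bool as Bool using (Bool; true; false; T; _∧_; _∨_; not)
open import Data.Bool.ListAction using (and; or)
open import Data.Bool.Properties using (T?; T-≡; ⇔→≡; not-injective; ¬-not; ∨-zeroʳ)
open import Data.Empty using (⊥-elim)
open import Data.Fin as Fin using (Fin; zero; suc; toℕ; fromℕ; fromℕ<; inject₁; _≟_)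
open import Data.Fin.Patterns using (2F; 3F)
open import Data.Fin.Induction using (<-weakInduction; >-weakInduction)
open import Data.Fin.Permutation using (Permutation′; _⟨$⟩ʳ_; transpose)
import Data.Fin.Properties as Fin
open import Data.Fin.Properties using (pigeonhole; toℕ<n; toℕ-fromℕ<)
open import Data.Fin.Subset using (Subset; ∣_∣; inside; outside)
open import Data.List using (List; []; _∷_; _++_; map; foldr; length; filterᵇ; allFin)
open import Data.List.Membership.Propositional using (find; lose) renaming (_∈_ to _∈ₗ_)
open import Data.List.Membership.Propositional.Properties using (∈-allFin; ∈-filter⁺; ∈-filter⁻)
open import Data.List.Properties using (length-removeAt′; length-map; length-++)
open import Data.List.Relation.Unary.All as All using (All; []; _∷_)
open import Data.List.Relation.Unary.AllPairs as AllPairs using (AllPairs; []; _∷_)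
open import Data.List.Relation.Unary.Any as Any using (Any; here; there; _─_)
import Data.List.Relation.Unary.All.Properties as All
import Data.List.Relation.Unary.AllPairs.Properties as AllPairs
import Data.List.Relation.Unary.Any.Properties as Any
open import Data.List.Relation.Unary.Unique.Propositional using (Unique)
open import Data.List.Relation.Unary.Unique.Propositional.Properties using (allFin⁺)
open import Data.Nat as ℕ using (ℕ; zero; suc; _+_; _*_; _≤_; _<_; _⊔_; z≤n; s≤s; z<s)
open import Data.Nat.Properties using
  (≤-refl; ≤-reflexive; ≤-trans; ≤-total; <-irrefl; <⇒≤; ≮⇒≥; ≰⇒>; +-comm; +-assoc; +-identityʳ;
  +-monoʳ-<; _<?_; _≤?_; anyUpTo?; m≤n+m; m≤n⇒m<n∨m≡n; m≤n⇒∃[o]m+o≡n; m≤m⊔n; m≤n⊔m; module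
  ≤-Reasoning; n<1+n; m<1+n⇒m<n∨m≡n)
open import Data.Product using (Σ; ∃; _×_; _,_; proj₁; proj₂)
open import Data.Sum using (_⊎_; inj₁; inj₂)
open import Data.Vec using ([]; _∷_)
open import Data.Vec.Properties using ([]=⇒lookup; lookup⇒[]=)
open import Function using (_∘_)
open import Function.Bundles using (Equivalence; Injection; mk⇔)
open import Function.Definitions using (Injective)
open import Function.Properties.Inverse using (↔⇒↣)
open import Relation.Binary.PropositionalEquality using
  (_≡_; _≢_; _≗_; refl; sym; trans; cong; cong₂; subst; module ≡-Reasoning)
open import Relation.Nullary using (¬_; Dec; yes; no; contradiction)
open import Relation.Nullary.Decidable using (⌊_⌋; toWitness; fromWitness; map′)

-- Iteration

iter-+ : ∀ {A : Set} (f : A → A) i j x → iter f (i + j) x ≡ iter f i (iter f j x)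
iter-+ f zero    j x = refl
iter-+ f (suc i) j x = cong f (iter-+ f i j x)

iter-shift : ∀ {A : Set} (f : A → A) k x → iter f k (f x) ≡ f (iter f k x)
iter-shift f zero    x = refl
iter-shift f (suc k) x = cong f (iter-shift f k x)

iter-agree : ∀ {A : Set} {f g : A → A} {x} →
  (∀ k → g (iter f k x) ≡ f (iter f k x)) → ∀ k → iter g k x ≡ iter f k x
iter-agree {g = g} eq zero    = refl
iter-agree {g = g} eq (suc k) = trans (cong g (iter-agree eq k)) (eq k)

iter-injective : ∀ {A : Set} {f : A → A} → Injective _≡_ _≡_ f →
  ∀ k → Injective _≡_ _≡_ (iter f k)
iter-injective inj zero    eq = eq
iter-injective inj (suc k) eq = iter-injective inj k (inj eq)

least : ∀ {P : ℕ → Set} → (∀ k → Dec (P k)) → ∀ k → P k →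
  ∃ λ m → P m × (∀ j → j < m → ¬ P j)
least P? zero    p = 0 , p , λ _ ()
least P? (suc k) p with P? 0
... | yes p₀ = 0 , p₀ , λ _ ()
... | no ¬p₀ with m , pm , min ← least (P? ∘ suc) k p =
  suc m , pm , λ { zero _ → ¬p₀ ; (suc j) (s≤s j<m) → min j j<m }

Reaches : ∀ {A : Set} → (A → A) → A → A → Set
Reaches f x y = ∃ λ k → iter f k x ≡ y

reaches-trans : ∀ {A : Set} {f : A → A} {x y z} → Reaches f x y → Reaches f y z → Reaches f x z
reaches-trans {f = f} {x} (k , refl) (l , refl) = l + k , iter-+ f l k x

reaches-step : ∀ {A : Set} {f : A → A} {x y} → Reaches f x y → Reaches f x (f y)
reaches-step {f = f} (k , eq) = suc k , cong f eq

Transitive : ∀ {A : Set} → (A → A) → Set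
Transitive f = ∀ x y → Reaches f x y

module _ {n : ℕ} (f : Fin n → Fin n) where

  reaches-least : ∀ {x y} → Reaches f x y →
    ∃ λ k → iter f k x ≡ y × (∀ j → j < k → iter f j x ≢ y)
  reaches-least {x} {y} (k , eq) = least (λ j → iter f j x ≟ y) k eq

  iter-repeats : ∀ x → ∃ λ i → ∃ λ d → suc d + i ≤ n × iter f (suc d + i) x ≡ iter f i x
  iter-repeats x with pigeonhole (n<1+n n) (λ i → iter f (toℕ i) x)
  ... | i , j , i<j , eq with m≤n⇒∃[o]m+o≡n i<j
  ... | d , i+d≡j = toℕ i , d , subst (_≤ n) j≡ (<⇒≤pred (toℕ<n j)) , trans (cong (λ k → iter f k x) (sym j≡)) (sym eq)
    where
    <⇒≤pred : ∀ {a b} → a < suc b → a ≤ b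
    <⇒≤pred (s≤s p) = p
    j≡ : toℕ j ≡ suc d + toℕ i
    j≡ = trans (sym i+d≡j) (cong suc (+-comm (toℕ i) d))

  -- If the least time were at least `n`, it would come no earlier than the repetition at times `i`
  -- and `suc d + i`; cutting out those `suc d` steps gives an earlier visit to `y`. This is why
  -- testing `n` iterates, as `orbitAll` and `orbitAny` do, covers the whole orbit.
  reaches-bounded : ∀ {x y} → Reaches f x y → ∃ λ k → k < n × iter f k x ≡ y
  reaches-bounded {x} {y} r with reaches-least r
  ... | k , eq , min with k <? n
  ... | yes k<n = k , k<n , eq
  ... | no  k≮n with i , d , le , rep ← iter-repeats x
    with o , refl ← m≤n⇒∃[o]m+o≡n (≤-trans le (≮⇒≥ k≮n)) =
    contradiction shorter (min (o + i) o+i<)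
    where
    o+i< : o + i < suc d + i + o
    o+i< = s≤s (≤-trans (≤-reflexive (+-comm o i))
      (≤-trans (m≤n+m (i + o) d) (≤-reflexive (sym (+-assoc d i o)))))
    shorter : iter f (o + i) x ≡ y
    shorter = begin
      iter f (o + i) x                   ≡⟨ iter-+ f o i x ⟩
      iter f o (iter f i x)              ≡⟨ cong (iter f o) rep ⟨
      iter f o (iter f (suc d + i) x)    ≡⟨ iter-+ f o (suc d + i) x ⟨
      iter f (o + (suc d + i)) x         ≡⟨ cong (λ k → iter f k x) (+-comm o (suc d + i)) ⟩
      iter f (suc d + i + o) x           ≡⟨ eq ⟩
      y                                  ∎
      where open ≡-Reasoning

  module _ (inj : Injective _≡_ _≡_ f) where

    periodic : ∀ x → ∃ λ d → iter f (suc d) x ≡ x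
    periodic x with i , d , _ , rep ← iter-repeats x = d , iter-injective inj i (begin
      iter f i (iter f (suc d) x)  ≡⟨ iter-+ f i (suc d) x ⟨
      iter f (i + suc d) x         ≡⟨ cong (λ k → iter f k x) (+-comm i (suc d)) ⟩
      iter f (suc d + i) x         ≡⟨ rep ⟩
      iter f i x                   ∎)
      where open ≡-Reasoning

    unstep : ∀ x → Reaches f (f x) x
    unstep x with d , eq ← periodic x = d , trans (iter-shift f d x) eq

    reaches-sym : ∀ {x y} → Reaches f x y → Reaches f y x
    reaches-sym (zero  , refl) = 0 , refl
    reaches-sym {x} (suc k , refl) =
      reaches-trans {f = f} (unstep (iter f k x)) (reaches-sym (k , refl))

  -- The orbit of w repeats from time k + 1 on, so y must have appeared by time k.
  first-return : ∀ {w x y} k l → iter f k w ≡ x → f x ≡ w → iter f l w ≡ y →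
    (∀ j → j < l → iter f j w ≢ y) → k ≤ l → x ≡ y
  first-return {w} k l eqk fx≡w eql min k≤l with m≤n⇒m<n∨m≡n k≤l
  ... | inj₂ refl = trans (sym eqk) eql
  ... | inj₁ k<l with o , refl ← m≤n⇒∃[o]m+o≡n k<l =
    contradiction (begin
      iter f o w                   ≡⟨ cong (iter f o) fx≡w ⟨
      iter f o (f _)               ≡⟨ cong (iter f o ∘ f) eqk ⟨
      iter f o (iter f (suc k) w)  ≡⟨ iter-+ f o (suc k) w ⟨
      iter f (o + suc k) w         ≡⟨ cong (λ i → iter f i w) (+-comm o (suc k)) ⟩
      iter f (suc k + o) w         ≡⟨ eql ⟩
      _                            ∎) (min o (s≤s (m≤n+m o k)))
    where open ≡-Reasoning

  -- Both `x` and `y` are reached from their common image `f x`. Whichever is reached first closes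
  -- the orbit there, so the other coincides with it.
  transitive⇒injective : Transitive f → Injective _≡_ _≡_ f
  transitive⇒injective tr {x} {y} fx≡fy
    with k , eqk , mink ← reaches-least (tr (f x) x)
       | l , eql , minl ← reaches-least (tr (f x) y)
    with ≤-total k l
  ... | inj₁ k≤l = first-return k l eqk refl eql minl k≤l
  ... | inj₂ l≤k = sym (first-return l k eql (sym fx≡fy) eqk mink l≤k)

-- Cyclic order and multiplication by a 3-cycle

-- Meets f x y z: following f from x, one meets y before z.
Meets : ∀ {n} → (Fin n → Fin n) → Fin n → Fin n → Fin n → Set
Meets f x y z = ∃ λ k → iter f k x ≡ y
  × (∀ j → j < k → iter f j x ≢ y) × (∀ j → j ≤ k → iter f j x ≢ z)

-- Suppose `x` were met no later than `z` on the way from `y`. The remaining `d` steps from `x` to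
-- `z` either stay on the path from `x` to `y`, which avoids `z`, or pass through `y` again, which
-- gives a shorter way from `y` to `z`.
meets-rotate : ∀ {n} {f : Fin n → Fin n} {x y z} → Transitive f → x ≢ y →
  Meets f x y z → Meets f y z x
meets-rotate {f = f} {x} {y} {z} tr x≢y (k , eqk , _ , avoid)
  with m , eqm , minm ← reaches-least f (tr y z) = m , eqm , minm , avoid-x
  where
  avoid-x : ∀ j → j ≤ m → iter f j y ≢ x
  avoid-x zero    _   eq = x≢y (sym eq)
  avoid-x (suc j) j<m eq with d , refl ← m≤n⇒∃[o]m+o≡n j<m
    with d ≤? k
  ... | yes d≤k = avoid d d≤k (trans (cong (iter f d) (sym eq))
    (trans (sym (iter-+ f d (suc j) y)) (trans (cong (λ i → iter f i y) (+-comm d (suc j))) eqm)))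
  ... | no d≰k with o , refl ← m≤n⇒∃[o]m+o≡n (<⇒≤ (≰⇒> d≰k)) =
    minm o (s≤s (≤-trans (m≤n+m o k) (m≤n+m (k + o) j))) (begin
      iter f o y                          ≡⟨ cong (iter f o) eqk ⟨
      iter f o (iter f k x)               ≡⟨ cong (iter f o ∘ iter f k) eq ⟨
      iter f o (iter f k (iter f (suc j) y)) ≡⟨ cong (iter f o) (iter-+ f k (suc j) y) ⟨
      iter f o (iter f (k + suc j) y)     ≡⟨ iter-+ f o (k + suc j) y ⟨
      iter f (o + (k + suc j)) y          ≡⟨ cong (λ i → iter f i y) (trans (sym (+-assoc o k (suc j))) (trans (+-comm (o + k) (suc j)) (cong (suc j +_) (+-comm o k)))) ⟩
      iter f (suc j + (k + o)) y          ≡⟨ eqm ⟩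
      z                                   ∎)
    where open ≡-Reasoning

-- g = f ∘ (a b c).
record Rotated {A B : Set} (a b c : A) (f g : A → B) : Set where
  field
    at-a : g a ≡ f b
    at-b : g b ≡ f c
    at-c : g c ≡ f a
    off  : ∀ {z} → z ≢ a → z ≢ b → z ≢ c → g z ≡ f z

open Rotated

-- `(b a c)` is the inverse of `(a b c)`, so exchanging the two labels undoes the rotation. A
-- statement about merging cycles thereby also serves for splitting them.
rotated-inverse : ∀ {A B : Set} {a b c : A} {f g : A → B} →
  Rotated a b c f g → Rotated b a c g f
rotated-inverse r = record
  { at-a = sym (at-a r) ; at-b = sym (at-c r) ; at-c = sym (at-b r)
  ; off = λ z≢b z≢a z≢c → sym (off r z≢a z≢b z≢c) }

rotated-∘ : ∀ {A B C : Set} {a b c : A} {f g : A → B} (h : B → C) →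
  Rotated a b c f g → Rotated a b c (h ∘ f) (h ∘ g)
rotated-∘ h r = record
  { at-a = cong h (at-a r) ; at-b = cong h (at-b r) ; at-c = cong h (at-c r)
  ; off = λ z≢a z≢b z≢c → cong h (off r z≢a z≢b z≢c) }

rotated-respʳ : ∀ {A B : Set} {a b c : A} {f g h : A → B} → g ≗ h →
  Rotated a b c f g → Rotated a b c f h
rotated-respʳ {a = a} {b} {c} eq r = record
  { at-a = trans (sym (eq a)) (at-a r) ; at-b = trans (sym (eq b)) (at-b r)
  ; at-c = trans (sym (eq c)) (at-c r)
  ; off = λ z≢a z≢b z≢c → trans (sym (eq _)) (off r z≢a z≢b z≢c) }

rotated-unique : ∀ {n} {B : Set} {a b c : Fin n} {f g h : Fin n → B} →
  Rotated a b c f g → Rotated a b c f h → g ≗ h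
rotated-unique {a = a} {b} {c} r s z with z ≟ a
... | yes refl = trans (at-a r) (sym (at-a s))
... | no z≢a with z ≟ b
... | yes refl = trans (at-b r) (sym (at-b s))
... | no z≢b with z ≟ c
... | yes refl = trans (at-c r) (sym (at-c s))
... | no z≢c = trans (off r z≢a z≢b z≢c) (sym (off s z≢a z≢b z≢c))

module _ {n : ℕ} {B : Set} (a b c : Fin n) (f : Fin n → B) where

  rotate : Fin n → B
  rotate z with z ≟ a | z ≟ b | z ≟ c
  ... | yes _ | _     | _     = f b
  ... | no _  | yes _ | _     = f c
  ... | no _  | no _  | yes _ = f a
  ... | no _  | no _  | no _  = f z

  rotate-rotated : a ≢ b → b ≢ c → c ≢ a → Rotated a b c f rotate
  rotate-rotated a≢b b≢c c≢a = record { at-a = ra ; at-b = rb ; at-c = rc ; off = ro }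
    where
    ra : rotate a ≡ f b
    ra with a ≟ a
    ... | yes _ = refl
    ... | no a≢a = contradiction refl a≢a
    rb : rotate b ≡ f c
    rb with b ≟ a | b ≟ b
    ... | yes b≡a | _ = contradiction (sym b≡a) a≢b
    ... | no _ | yes _ = refl
    ... | no _ | no b≢b = contradiction refl b≢b
    rc : rotate c ≡ f a
    rc with c ≟ a | c ≟ b | c ≟ c
    ... | yes c≡a | _ | _ = contradiction c≡a c≢a
    ... | no _ | yes c≡b | _ = contradiction (sym c≡b) b≢c
    ... | no _ | no _ | yes _ = refl
    ... | no _ | no _ | no c≢c = contradiction refl c≢c
    ro : ∀ {z} → z ≢ a → z ≢ b → z ≢ c → rotate z ≡ f z
    ro {z} z≢a z≢b z≢c with z ≟ a | z ≟ b | z ≟ c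
    ... | yes z≡a | _ | _ = contradiction z≡a z≢a
    ... | no _ | yes z≡b | _ = contradiction z≡b z≢b
    ... | no _ | no _ | yes z≡c = contradiction z≡c z≢c
    ... | no _ | no _ | no _ = refl

-- Strictly between its ends, the path of `f` from `x` to `y` avoids the three points where `g` may
-- differ from `f`; a return to `x` would bring `y` sooner. So `g`, having entered the path by
-- `g u ≡ f x`, stays on it up to `y`.
reaches-along : ∀ {n} {f g : Fin n → Fin n} {u x y z} → x ≢ y → Meets f x y z →
  (∀ {w} → w ≢ x → w ≢ y → w ≢ z → g w ≡ f w) → g u ≡ f x → Reaches g u y
reaches-along x≢y (zero , eq , _) agree gu = contradiction eq x≢y
reaches-along {f = f} {g} {u} {x} {y} x≢y (suc k , eqk , min , avoid) agree gu =
  suc k , trans (follow k ≤-refl) eqk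
  where
  no-return : ∀ i → suc i ≤ k → iter f (suc i) x ≢ x
  no-return i i<k eq with d , refl ← m≤n⇒∃[o]m+o≡n i<k =
    min (suc d) (s≤s (s≤s (m≤n+m d i))) (begin
      iter f (suc d) x                    ≡⟨ cong (iter f (suc d)) eq ⟨
      iter f (suc d) (iter f (suc i) x)   ≡⟨ iter-+ f (suc d) (suc i) x ⟨
      iter f (suc d + suc i) x            ≡⟨ cong (λ j → iter f (suc j) x) (+-comm d (suc i)) ⟩
      iter f (suc (suc i + d)) x          ≡⟨ eqk ⟩
      y                                   ∎)
    where open ≡-Reasoning
  follow : ∀ i → i ≤ k → iter g (suc i) u ≡ iter f (suc i) x
  follow zero    _   = gu
  follow (suc i) i<k = trans (cong g (follow i (<⇒≤ i<k)))
    (agree (no-return i i<k) (min (suc i) (s≤s i<k)) (avoid (suc i) (≤-trans i<k (m≤n+m k 1))))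

-- If a, b, c occur in this cyclic order, f = (a Q b P c R) becomes (a P c Q b R).
rotated-transitive : ∀ {n} {a b c : Fin n} {f g} → Transitive f → Rotated a b c f g →
  Meets f b c a → a ≢ b → b ≢ c → c ≢ a → Transitive g
rotated-transitive {a = a} {b} {c} {f} {g} tr r m a≢b b≢c c≢a x y =
  reaches-trans {f = g} (to-a (proj₁ (tr x a)) (proj₂ (tr x a))) (from-a (tr a y))
  where
  m′ : Meets f c a b
  m′ = meets-rotate tr b≢c m
  a⇝c : Reaches g a c
  a⇝c = reaches-along b≢c m (λ p q s → off r s p q) (at-a r)
  b⇝a : Reaches g b a
  b⇝a = reaches-along c≢a m′ (λ p q s → off r q s p) (at-b r)
  c⇝b : Reaches g c b
  c⇝b = reaches-along a≢b (meets-rotate tr c≢a m′) (off r) (at-c r)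

  -- Off the three points both maps agree, so `g` follows the `f`-path to `a` until it hits one of
  -- them.
  to-a : ∀ {x} k → iter f k x ≡ a → Reaches g x a
  to-a zero eq = zero , eq
  to-a {x} (suc k) eq with x ≟ a | x ≟ b | x ≟ c
  ... | yes refl | _ | _ = 0 , refl
  ... | no _ | yes refl | _ = b⇝a
  ... | no _ | no _ | yes refl = reaches-trans {f = g} c⇝b b⇝a
  ... | no x≢a | no x≢b | no x≢c =
    reaches-trans {f = g} (1 , off r x≢a x≢b x≢c) (to-a k (trans (iter-shift f k x) eq))

  -- The `g`-orbit of `a` contains `a`, `b` and `c`, whose `g`-images are their `f`-images in
  -- another order; hence it is closed under `f`.
  image : ∀ w → Reaches g a w → Reaches g a (f w)
  image w a⇝w with w ≟ a | w ≟ b | w ≟ c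
  ... | yes refl | _ | _ = subst (Reaches g a) (at-c r) (reaches-step {f = g} a⇝c)
  ... | no _ | yes refl | _ = 1 , at-a r
  ... | no _ | no _ | yes refl = subst (Reaches g a) (at-b r)
    (reaches-step {f = g} (reaches-trans {f = g} a⇝c c⇝b))
  ... | no w≢a | no w≢b | no w≢c = subst (Reaches g a) (off r w≢a w≢b w≢c) (reaches-step {f = g} a⇝w)

  from-a : ∀ {y} → Reaches f a y → Reaches g a y
  from-a (zero  , eq)   = 0 , eq
  from-a (suc k , refl) = image _ (from-a (k , refl))

-- Boolean and list encodings

T⇒≡true : ∀ {b} → T b → b ≡ true
T⇒≡true = Equivalence.to T-≡

≡true⇒T : ∀ {b} → b ≡ true → T b
≡true⇒T = Equivalence.from T-≡

∧-true : ∀ {a b} → a ≡ true → b ≡ true → a ∧ b ≡ true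
∧-true refl refl = refl

∧-true⁻ : ∀ {a b} → a ∧ b ≡ true → a ≡ true × b ≡ true
∧-true⁻ {true} eq = refl , eq

allᵇ⁺ : ∀ {n} (p : Fin n → Bool) → (∀ i → p i ≡ true) → allᵇ p ≡ true
allᵇ⁺ {n} p h = go (allFin n)
  where
  go : ∀ xs → and (map p xs) ≡ true
  go []       = refl
  go (x ∷ xs) = ∧-true (h x) (go xs)

allᵇ⁻ : ∀ {n} (p : Fin n → Bool) → allᵇ p ≡ true → ∀ i → p i ≡ true
allᵇ⁻ {n} p eq i = go eq (∈-allFin i)
  where
  go : ∀ {xs} → and (map p xs) ≡ true → i ∈ₗ xs → p i ≡ true
  go eq (here refl) = proj₁ (∧-true⁻ eq)
  go {x ∷ _} eq (there i∈) = go (proj₂ (∧-true⁻ {p x} eq)) i∈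

anyᵇ⁺ : ∀ {n} (p : Fin n → Bool) i → p i ≡ true → anyᵇ p ≡ true
anyᵇ⁺ {n} p i pi = go (∈-allFin i)
  where
  go : ∀ {xs} → i ∈ₗ xs → or (map p xs) ≡ true
  go (here refl) rewrite pi = refl
  go {x ∷ _} (there i∈) rewrite go i∈ = ∨-zeroʳ (p x)

anyᵇ⁻ : ∀ {n} (p : Fin n → Bool) → anyᵇ p ≡ true → ∃ λ i → p i ≡ true
anyᵇ⁻ {n} p = go (allFin n)
  where
  go : ∀ xs → or (map p xs) ≡ true → ∃ λ i → p i ≡ true
  go (x ∷ xs) eq with p x in px
  ... | true  = x , px
  ... | false = go xs eq

==⁺ : ∀ {n} {i j : Fin n} → i ≡ j → (i == j) ≡ true
==⁺ eq = T⇒≡true (fromWitness eq)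

==⁻ : ∀ {n} {i j : Fin n} → (i == j) ≡ true → i ≡ j
==⁻ eq = toWitness (≡true⇒T eq)

orbitAll⁺ : ∀ {n} (f : Fin n → Fin n) x p → (∀ k → p (iter f k x) ≡ true) → orbitAll f x p ≡ true
orbitAll⁺ {n} f x p h = allᵇ⁺ {n} _ (λ k → h (toℕ k))

orbitAll⁻ : ∀ {n} (f : Fin n → Fin n) x p → orbitAll f x p ≡ true → ∀ k → p (iter f k x) ≡ true
orbitAll⁻ f x p eq k with j , j<n , same ← reaches-bounded f (k , refl) =
  subst (λ z → p z ≡ true) (trans (cong (λ i → iter f i x) (toℕ-fromℕ< j<n)) same)
    (allᵇ⁻ _ eq (fromℕ< j<n))

isCyclicᵇ⁺ : ∀ {n} {f : Fin n → Fin n} → Transitive f → isCyclicᵇ f ≡ true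
isCyclicᵇ⁺ {n} {f} tr = ∧-true
  (allᵇ⁺ _ λ i → allᵇ⁺ _ λ j → injᵇ i j)
  (allᵇ⁺ _ λ x → allᵇ⁺ _ λ y → reachᵇ x y)
  where
  injᵇ : ∀ i j → (not (f i == f j) ∨ (i == j)) ≡ true
  injᵇ i j with f i ≟ f j
  ... | yes eq = ==⁺ (transitive⇒injective f tr eq)
  ... | no _   = refl
  reachᵇ : ∀ x y → orbitAny f x (λ z → z == y) ≡ true
  reachᵇ x y with k , k<n , eq ← reaches-bounded f (tr x y) =
    anyᵇ⁺ {n} _ (fromℕ< k<n) (==⁺ (trans (cong (λ i → iter f i x) (toℕ-fromℕ< k<n)) eq))

isCyclicᵇ⁻ : ∀ {n} {f : Fin n → Fin n} → isCyclicᵇ f ≡ true → Transitive f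
isCyclicᵇ⁻ {n} {f} eq x y
  with k , e ← anyᵇ⁻ {n} _ (allᵇ⁻ _ (allᵇ⁻ _ (proj₂ (∧-true⁻ {isPermᵇ f} eq)) x) y) = toℕ k , ==⁻ e

module _ {A : Set} {p q : A → Bool} where

  filterᵇ-cong : ∀ {xs} → All (λ x → p x ≡ q x) xs → filterᵇ p xs ≡ filterᵇ q xs
  filterᵇ-cong [] = refl
  filterᵇ-cong {x ∷ _} (eq ∷ eqs) with p x | q x | eq
  ... | true  | _ | refl = cong (x ∷_) (filterᵇ-cong eqs)
  ... | false | _ | refl = filterᵇ-cong eqs

  length-filterᵇ-remove : ∀ {m xs} → Unique xs → m ∈ₗ xs → p m ≡ true → q m ≡ false →
    (∀ x → x ≢ m → p x ≡ q x) → length (filterᵇ p xs) ≡ suc (length (filterᵇ q xs))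
  length-filterᵇ-remove (m∉ ∷ _) (here refl) pm qm eq rewrite pm | qm =
    cong (suc ∘ length) (filterᵇ-cong (All.map (λ m≢x → eq _ (m≢x ∘ sym)) m∉))
  length-filterᵇ-remove {xs = x ∷ _} (x∉ ∷ uniq) (there m∈) pm qm eq
    with p x | q x | eq x (All.lookup x∉ m∈)
  ... | true  | _ | refl = cong suc (length-filterᵇ-remove uniq m∈ pm qm eq)
  ... | false | _ | refl = length-filterᵇ-remove uniq m∈ pm qm eq

∈-filterᵇ⁺ : ∀ {A : Set} {p : A → Bool} {x xs} → x ∈ₗ xs → p x ≡ true → x ∈ₗ filterᵇ p xs
∈-filterᵇ⁺ x∈ px = ∈-filter⁺ _ x∈ (≡true⇒T px)

∈-filterᵇ⁻ : ∀ {A : Set} {p : A → Bool} {x xs} → x ∈ₗ filterᵇ p xs → x ∈ₗ xs × p x ≡ true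
∈-filterᵇ⁻ {p = p} {xs = xs} x∈ with x∈xs , px ← ∈-filter⁻ (T? ∘ p) {xs = xs} x∈ = x∈xs , T⇒≡true px

-- _≈_ is pointwise equality in the application: without function
-- extensionality, allFuns lists functions only up to _≗_.
module _ {A B : Set} (_≈_ : A → A → Set) {R : A → B → Set}
  (inj : ∀ {x x′ y} → R x y → R x′ y → x ≈ x′) where

  any-─ : ∀ {x x′ ys} → ¬ x ≈ x′ → (p : Any (R x) ys) → Any (R x′) ys → Any (R x′) (ys ─ p)
  any-─ x≉ (here r)  (here r′)  = contradiction (inj r r′) x≉
  any-─ x≉ (here r)  (there q)  = q
  any-─ x≉ (there p) (here r′)  = here r′
  any-─ x≉ (there p) (there q)  = there (any-─ x≉ p q)

  -- The partner of the head is removed from `ys`. By `inj` no later element relies on it, so each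
  -- of them keeps a partner and the induction goes on.
  length-≤ : ∀ {xs ys} → AllPairs (λ x x′ → ¬ x ≈ x′) xs → All (λ x → Any (R x) ys) xs →
    length xs ≤ length ys
  length-≤ [] [] = z≤n
  length-≤ {ys = ys} (x≉ ∷ uniq) (p ∷ ps) =
    subst (_ ≤_) (sym (length-removeAt′ ys (Any.index p)))
      (s≤s (length-≤ uniq (All.zipWith (λ (x≉x′ , q) → any-─ x≉x′ p q) (x≉ , ps))))

allFuns-complete : ∀ n m (g : Fin n → Fin m) → Any (g ≗_) (allFuns n m)
allFuns-complete zero    m g = here λ ()
allFuns-complete (suc n) m g = Any.concat⁺ (Any.map⁺ (Any.map
  (λ eq → Any.map⁺ (lose (∈-allFin (g zero)) λ { zero → refl ; (suc i) → eq i }))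
  (allFuns-complete n m (g ∘ suc))))

allFuns-unique : ∀ n m → AllPairs (λ f g → ¬ f ≗ g) (allFuns n m)
allFuns-unique zero    m = [] ∷ []
allFuns-unique (suc n) m = AllPairs.concat⁺
  (All.map⁺ (All.universal (λ f → AllPairs.map⁺ (AllPairs.map (λ i≢j eq → i≢j (eq zero)) (allFin⁺ m))) _))
  (AllPairs.map⁺ (AllPairs.map
    (λ f≉g → All.map⁺ (All.universal (λ y → All.map⁺ (All.universal (λ y′ eq → f≉g (eq ∘ suc)) _)) _))
    (allFuns-unique n m)))

-- Label-free cycles

LabelFree : ∀ {n} → Subset n → (Fin n → Fin n) → Fin n → Set
LabelFree E f x = ∀ k → inᵇ (iter f k x) E ≡ false

module _ {n : ℕ} (E : Subset n) where

  private
    -- Copies of the test local to `cE`, so that `cE E f` unfolds to the length of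
    -- `filterᵇ (isRepᵇ f) (allFin n)`.
    labelFreeᵇ isRepᵇ : (Fin n → Fin n) → Fin n → Bool
    labelFreeᵇ f x = orbitAll f x (λ z → not (inᵇ z E))
    isRepᵇ f x = labelFreeᵇ f x ∧ orbitAll f x (λ z → x ≤ᵇ z)

  labelFreeᵇ⁺ : ∀ {f x} → LabelFree E f x → labelFreeᵇ f x ≡ true
  labelFreeᵇ⁺ {f} {x} lf = orbitAll⁺ f x (λ z → not (inᵇ z E)) (λ k → cong not (lf k))

  labelFreeᵇ⁻ : ∀ {f x} → labelFreeᵇ f x ≡ true → LabelFree E f x
  labelFreeᵇ⁻ {f} {x} eq k = not-injective (orbitAll⁻ f x (λ z → not (inᵇ z E)) eq k)

  labelFree? : ∀ f x → Dec (LabelFree E f x)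
  labelFree? f x = map′ (labelFreeᵇ⁻ {f} {x}) labelFreeᵇ⁺ (labelFreeᵇ f x Bool.≟ true)

  IsRep : (Fin n → Fin n) → Fin n → Set
  IsRep f x = LabelFree E f x × (∀ k → x Fin.≤ iter f k x)

  isRepᵇ⁺ : ∀ {f x} → IsRep f x → isRepᵇ f x ≡ true
  isRepᵇ⁺ {f} {x} (lf , least) =
    ∧-true (labelFreeᵇ⁺ {f} {x} lf) (orbitAll⁺ f x (x ≤ᵇ_) (λ k → T⇒≡true (fromWitness (least k))))

  isRepᵇ⁻ : ∀ {f x} → isRepᵇ f x ≡ true → IsRep f x
  isRepᵇ⁻ {f} {x} eq with e₁ , e₂ ← ∧-true⁻ {labelFreeᵇ f x} eq =
    labelFreeᵇ⁻ {f} {x} e₁ , λ k → toWitness (≡true⇒T (orbitAll⁻ f x (x ≤ᵇ_) e₂ k))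

  isRepᵇ-cong : ∀ {f g x y} → (IsRep f x → IsRep g y) → (IsRep g y → IsRep f x) →
    isRepᵇ f x ≡ isRepᵇ g y
  isRepᵇ-cong {f} {g} {x} {y} to from =
    ⇔→≡ (mk⇔ (isRepᵇ⁺ {g} {y} ∘ to ∘ isRepᵇ⁻ {f} {x}) (isRepᵇ⁺ {f} {x} ∘ from ∘ isRepᵇ⁻ {g} {y}))

  isRep-resp : ∀ {f g x} → (∀ k → iter f k x ≡ iter g k x) → IsRep f x → IsRep g x
  isRep-resp {x = x} eq (lf , least) =
    (λ k → subst (λ z → inᵇ z E ≡ false) (eq k) (lf k)) ,
    (λ k → subst (x Fin.≤_) (eq k) (least k))

  cE-cong : ∀ {f g} → f ≗ g → cE E f ≡ cE E g
  cE-cong {f} {g} f≗g = cong length (filterᵇ-cong {p = isRepᵇ f} {q = isRepᵇ g} (All.universal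
    (λ x → isRepᵇ-cong {f} {g} (isRep-resp (iter≗ x)) (isRep-resp (sym ∘ iter≗ x))) (allFin n)))
    where
    iter≗ : ∀ x k → iter f k x ≡ iter g k x
    iter≗ x = iter-agree (λ k → f≗g _)

  labelFree-reaches : ∀ {f x y} → Reaches f x y → LabelFree E f x → LabelFree E f y
  labelFree-reaches {f} {x} (k , refl) lf j = subst (λ z → inᵇ z E ≡ false) (iter-+ f j k x) (lf (j + k))

  labelFree-∉ : ∀ {f x e} → inᵇ e E ≡ true → LabelFree E f x → ∀ k → iter f k x ≢ e
  labelFree-∉ e∈E lf k refl with () ← trans (sym e∈E) (lf k)

  isRep⇒cE>0 : ∀ {f x} → IsRep f x → 0 < cE E f
  isRep⇒cE>0 {f} {x} rep with filterᵇ (isRepᵇ f) (allFin n)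
    | ∈-filterᵇ⁺ {p = isRepᵇ f} (∈-allFin x) (isRepᵇ⁺ {f} {x} rep)
  ... | _ ∷ _ | _ = z<s

  cE>0⇒labelFree : ∀ {f} → 0 < cE E f → ∃ λ x → LabelFree E f x
  cE>0⇒labelFree {f} pos with filterᵇ (isRepᵇ f) (allFin n) in eq | pos
  ... | []    | ()
  ... | x ∷ _ | _ = x , proj₁ (isRepᵇ⁻ {f} {x}
    (proj₂ (∈-filterᵇ⁻ {p = isRepᵇ f} {xs = allFin n} (subst (x ∈ₗ_) (sym eq) (here refl)))))

  iter-min-below : ∀ f (x : Fin n) N → ∃ λ j → ∀ k → k < N → iter f j x Fin.≤ iter f k x
  iter-min-below f x zero = 0 , λ _ ()
  iter-min-below f x (suc N) with j , min ← iter-min-below f x N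
    with ≤-total (toℕ (iter f j x)) (toℕ (iter f N x))
  ... | inj₁ le = j , λ k k<1+N → go k (m<1+n⇒m<n∨m≡n k<1+N)
    where
    go : ∀ k → k < N ⊎ k ≡ N → iter f j x Fin.≤ iter f k x
    go k (inj₁ k<N)  = min k k<N
    go k (inj₂ refl) = le
  ... | inj₂ ge = N , λ k k<1+N → go k (m<1+n⇒m<n∨m≡n k<1+N)
    where
    go : ∀ k → k < N ⊎ k ≡ N → iter f N x Fin.≤ iter f k x
    go k (inj₁ k<N)  = ≤-trans ge (min k k<N)
    go k (inj₂ refl) = ≤-refl

  orbit-min : ∀ f (x : Fin n) → ∃ λ m → Reaches f x m × (∀ {z} → Reaches f x z → m Fin.≤ z)
  orbit-min f x with j , min ← iter-min-below f x n = iter f j x , (j , refl) , λ x⇝z →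
    let k , k<n , eq = reaches-bounded f x⇝z in subst (iter f j x Fin.≤_) eq (min k k<n)

  -- The label-free cycle of c is merged into the cycles of a and b, each of
  -- which keeps a label; all other label-free cycles are untouched.
  cE-rotated : ∀ {a b c f g} → Injective _≡_ _≡_ f → inᵇ a E ≡ true → inᵇ b E ≡ true →
    LabelFree E f c → Rotated a b c f g → cE E f ≡ suc (cE E g)
  cE-rotated {a} {b} {c} {f} {g} inj a∈E b∈E lfc r
    -- `m` is the one representative that is lost.
    with m , c⇝m , m-min ← orbit-min f c =
    length-filterᵇ-remove {p = isRepᵇ f} {q = isRepᵇ g} (allFin⁺ n) (∈-allFin m)
      (isRepᵇ⁺ {f} {m} (labelFree-reaches c⇝m lfc ,
        λ k → m-min (reaches-trans {f = f} c⇝m (k , refl))))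
      (¬-not (λ eq → orbit-labelled c⇝m (proj₁ (isRepᵇ⁻ {g} {m} eq))))
      (λ x x≢m → isRepᵇ-cong {f} {g} {x} {x} (to x x≢m) (from x))
    where
    g≡f : ∀ {z} → LabelFree E g z → z ≢ c → g z ≡ f z
    g≡f lf z≢c = off r (labelFree-∉ a∈E lf 0) (labelFree-∉ b∈E lf 0) z≢c

    -- Since `g c ≡ f a`, a label-free `g`-orbit of `c` would copy the `f`-cycle of `a`, which never
    -- meets `c`, until it arrives at the label `a`.
    c-labelled : ¬ LabelFree E g c
    c-labelled lf with k , eq ← unstep f inj a =
      labelFree-∉ a∈E lf (suc k) (trans (sym (iter-shift g k c)) (trans (agree k) eq))
      where
      avoids-c : ∀ j → iter f j (f a) ≢ c
      avoids-c j eq = let i , e = reaches-sym f inj {a} {c} (suc j , trans (sym (iter-shift f j a)) eq)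
        in labelFree-∉ a∈E lfc i e
      agree : ∀ j → iter g j (g c) ≡ iter f j (f a)
      agree zero    = at-c r
      agree (suc j) = trans
        (g≡f (labelFree-reaches {g} {c} (suc j , sym (iter-shift g j c)) lf)
          (λ eq → avoids-c j (trans (sym (agree j)) eq)))
        (cong f (agree j))

    reaches-c-labelled : ∀ k {z} → iter f k z ≡ c → ¬ LabelFree E g z
    reaches-c-labelled zero    refl lf = c-labelled lf
    reaches-c-labelled (suc k) {z} eq lf with z ≟ c
    ... | yes refl = c-labelled lf
    ... | no z≢c = reaches-c-labelled k (trans (iter-shift f k z) eq)
      (labelFree-reaches (1 , g≡f lf z≢c) lf)

    orbit-labelled : ∀ {z} → Reaches f c z → ¬ LabelFree E g z
    orbit-labelled c⇝z with k , eq ← reaches-sym f inj c⇝z = reaches-c-labelled k eq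

    to : ∀ x → x ≢ m → IsRep f x → IsRep g x
    to x x≢m (lf , x-min) = isRep-resp (sym ∘ iter-agree (λ k →
      off r (labelFree-∉ a∈E lf k) (labelFree-∉ b∈E lf k) (x≢c k))) (lf , x-min)
      where
      -- If the cycle of `x` contained `c`, then `x` and `m` would both be its least element.
      x≢c : ∀ k → iter f k x ≢ c
      x≢c k eq = x≢m (Fin.≤-antisym
        (let j , e = reaches-trans {f = f} (k , eq) c⇝m in subst (x Fin.≤_) e (x-min j))
        (m-min (reaches-sym f inj (k , eq))))

    from : ∀ x → IsRep g x → IsRep f x
    from x rep@(lf , _) = isRep-resp (sym ∘ iter-agree (λ k →
      sym (g≡f (labelFree-reaches (k , refl) lf)
        (λ eq → c-labelled (labelFree-reaches (k , eq) lf))))) rep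

-- Enumeration and existence of cyclic permutations

transitive-resp : ∀ {n} {f g : Fin n → Fin n} → f ≗ g → Transitive f → Transitive g
transitive-resp f≗g tr x y with k , eq ← tr x y =
  k , trans (iter-agree (λ j → sym (f≗g _)) k) eq

cyclicPerms-complete : ∀ {n} {g : Fin n → Fin n} → Transitive g →
  ∃ λ γ → γ ∈ₗ cyclicPerms n × g ≗ γ
cyclicPerms-complete {n} {g} tr with γ , γ∈ , g≗γ ← find (allFuns-complete n n g) =
  γ , ∈-filterᵇ⁺ γ∈ (isCyclicᵇ⁺ (transitive-resp g≗γ tr)) , g≗γ

cyclicPerms-transitive : ∀ {n} {γ : Fin n → Fin n} → γ ∈ₗ cyclicPerms n → Transitive γ
cyclicPerms-transitive {n} γ∈ = isCyclicᵇ⁻ (proj₂ (∈-filterᵇ⁻ {xs = allFuns n n} γ∈))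

≤-foldr-⊔ : ∀ {A : Set} (h : A → ℕ) {x xs} → x ∈ₗ xs → h x ≤ foldr _⊔_ 0 (map h xs)
≤-foldr-⊔ h (here refl) = m≤m⊔n _ _
≤-foldr-⊔ h {xs = y ∷ _} (there x∈) = ≤-trans (≤-foldr-⊔ h x∈) (m≤n⊔m (h y) _)

iter-fixed : ∀ {A : Set} {f : A → A} {x} → f x ≡ x → ∀ k → iter f k x ≡ x
iter-fixed         eq zero    = refl
iter-fixed {f = f} eq (suc k) = trans (cong f (iter-fixed eq k)) eq

countdown : ∀ {m} → Fin (suc m) → Fin (suc m)
countdown {m} zero = fromℕ m
countdown (suc i)  = inject₁ i

-- From `x` one steps down to zero, wraps round to the top, and steps down again to `y`.
countdown-transitive : ∀ m → Transitive (countdown {m})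
countdown-transitive m x y = reaches-trans {f = countdown}
  (reaches-step {f = countdown} (<-weakInduction (λ x → Reaches countdown x zero) (0 , refl)
    (λ i → reaches-trans {f = countdown} (1 , refl)) x))
  (>-weakInduction (Reaches countdown (fromℕ m)) (0 , refl) (λ i → reaches-step {f = countdown}) y)

transitive-exists : ∀ n → ∃ λ (f : Fin n → Fin n) → Transitive f
transitive-exists zero    = (λ ()) , λ ()
transitive-exists (suc m) = countdown , countdown-transitive m

-- Take the predecessor `x` of `y` in any full cycle `f`. Unless `x` is `c` already, rotating by
-- `(x y c)` sends `c` to `f x`, which is `y`. The result is again cyclic because `x` is the last
-- point before the return to `y`, so that `c` is met earlier.
transitive-through : ∀ {n} {c y : Fin n} → c ≢ y → ∃ λ g → Transitive g × g c ≡ y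
transitive-through {n} {c} {y} c≢y
  with f , tr ← transitive-exists n
  with k , eq ← tr (f y) y
  with k₀ , eq₀ , min₀ ← reaches-least f (tr y c)
  with iter f k y ≟ c
... | yes refl = f , tr , trans (sym (iter-shift f k y)) eq
... | no x≢c = rotate x y c f , rotated-transitive tr r meets x≢y (c≢y ∘ sym) (x≢c ∘ sym) ,
  trans (at-c r) fx≡y
  where
  x : Fin n
  x = iter f k y
  fx≡y : f x ≡ y
  fx≡y = trans (sym (iter-shift f k y)) eq
  x≢y : x ≢ y
  x≢y x≡y = c≢y (trans (sym eq₀) (iter-fixed (trans (cong f (sym x≡y)) fx≡y) k₀))
  r : Rotated x y c f (rotate x y c f)
  r = rotate-rotated x y c f x≢y (c≢y ∘ sym) (x≢c ∘ sym)
  avoid : ∀ j → j < k₀ ⊎ j ≡ k₀ → iter f j y ≢ x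
  avoid j (inj₂ refl) eqj = x≢c (trans (sym eqj) eq₀)
  avoid j (inj₁ j<k₀) eqj with o , refl ← m≤n⇒∃[o]m+o≡n j<k₀ =
    min₀ o (s≤s (m≤n+m o j)) (begin
      iter f o y                   ≡⟨ cong (iter f o) (trans (cong f eqj) fx≡y) ⟨
      iter f o (iter f (suc j) y)  ≡⟨ iter-+ f o (suc j) y ⟨
      iter f (o + suc j) y         ≡⟨ cong (λ i → iter f i y) (+-comm o (suc j)) ⟩
      iter f (suc j + o) y         ≡⟨ eq₀ ⟩
      c                            ∎)
    where open ≡-Reasoning
  meets : Meets f y c x
  meets = k₀ , eq₀ , min₀ , λ j j≤k₀ → avoid j (m≤n⇒m<n∨m≡n j≤k₀)

member : ∀ {n} (E : Subset n) → 0 < ∣ E ∣ → ∃ λ x → inᵇ x E ≡ true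
member (true  ∷ E) _   = zero , refl
member (false ∷ E) pos with x , x∈E ← member E pos = suc x , x∈E

two-members : ∀ {n} (E : Subset n) → 1 < ∣ E ∣ →
  ∃ λ x → ∃ λ y → inᵇ x E ≡ true × inᵇ y E ≡ true × x ≢ y
two-members (true  ∷ E) (s≤s pos) with y , y∈E ← member E pos = zero , suc y , refl , y∈E , λ ()
two-members (false ∷ E) lt with x , y , x∈E , y∈E , x≢y ← two-members E lt =
  suc x , suc y , x∈E , y∈E , λ { refl → x≢y refl }

-- The map on maximisers and its injectivity

module _ {n : ℕ} (D : Permutation′ n) (E : Subset n) where

  private
    Free : (Fin n → Fin n) → Fin n → Set
    Free γ = LabelFree E (D ∘ₚ γ)

  ∘ₚ-injective : ∀ {γ} → Transitive γ → Injective _≡_ _≡_ (D ∘ₚ γ)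
  ∘ₚ-injective {γ} tr = transitive⇒injective γ tr ∘ Injection.injective (↔⇒↣ D)

  cE≤θ : ∀ {g} → Transitive g → cE E (D ∘ₚ g) ≤ θ D E
  cE≤θ tr with γ , γ∈ , g≗γ ← cyclicPerms-complete tr =
    ≤-trans (≤-reflexive (cE-cong E (cong (D ⟨$⟩ʳ_) ∘ g≗γ))) (≤-foldr-⊔ (λ γ → cE E (D ∘ₚ γ)) γ∈)

  -- c is the first element of a label-free cycle of D ∘ γ met when following
  -- γ from b, and it is met before a.
  First : Fin n → Fin n → (Fin n → Fin n) → Fin n → Set
  First a b γ c = ∃ λ k → iter γ k b ≡ c × Free γ c ×
    (∀ j → j < k → ¬ Free γ (iter γ j b) × iter γ j b ≢ a)

  -- The graph of the map from `γ` to `γ′`, kept as a relation: a maximiser need not have a `First`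
  -- element for the given order of the labels, and `γ′` is determined only up to `_≗_`.
  Drop : Fin n → Fin n → (Fin n → Fin n) → (Fin n → Fin n) → Set
  Drop a b γ γ′ = Transitive γ × cE E (D ∘ₚ γ) ≡ θ D E ×
    ∃ λ c → First a b γ c × Rotated a b c γ γ′

  -- Consider the first element of a label-free cycle met from `b`. If `a` lies on the way, the rest
  -- of the path, starting at `a`, witnesses the exchanged case.
  first-exists : ∀ {a b γ c} → Transitive γ → a ≢ b → Free γ c →
    ∃ (First a b γ) ⊎ ∃ (First b a γ)
  first-exists {a} {b} {γ} {c} tr a≢b free
    with k , eqk ← tr b c
    with k , freek , mink ← least (λ j → labelFree? E (D ∘ₚ γ) (iter γ j b)) k
           (subst (Free γ) (sym eqk) free)
    with anyUpTo? (λ j → iter γ j b ≟ a) k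
  ... | no ¬a = inj₁ (iter γ k b , k , refl , freek , λ j j<k → mink j j<k , λ eq → ¬a (j , j<k , eq))
  ... | yes (j , j<k , refl) with o , refl ← m≤n⇒∃[o]m+o≡n (<⇒≤ j<k) =
    inj₂ (iter γ (j + o) b , o , from-a o , freek , λ i i<o →
      (λ fr → mink (j + i) (+-monoʳ-< j i<o) (subst (Free γ) (from-a i) fr)) ,
      no-b i i<o)
    where
    from-a : ∀ i → iter γ i (iter γ j b) ≡ iter γ (j + i) b
    from-a i = trans (sym (iter-+ γ i j b)) (cong (λ l → iter γ l b) (+-comm i j))
    no-b : ∀ i → i < o → iter γ i (iter γ j b) ≢ b
    -- After a return to `b` the orbit repeats, so the same label-free element would already occur
    -- at time `suc l`. That is too early, because `j` is nonzero by `a≢b`.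
    no-b i i<o eq with l , refl ← m≤n⇒∃[o]m+o≡n i<o =
      mink (suc l) (lt j a≢b) (subst (Free γ) later freek)
      where
      lt : ∀ j → iter γ j b ≢ b → suc l < j + (suc i + l)
      lt zero    b≢b = contradiction refl b≢b
      lt (suc j) _   = s≤s (≤-trans (s≤s (m≤n+m l i)) (m≤n+m (suc i + l) j))
      later : iter γ (j + (suc i + l)) b ≡ iter γ (suc l) b
      later = begin
        iter γ (j + (suc i + l)) b             ≡⟨ cong (λ m → iter γ m b) (+-comm j (suc i + l)) ⟩
        iter γ (suc (i + l + j)) b             ≡⟨ cong (λ m → iter γ (suc (m + j)) b) (+-comm i l) ⟩
        iter γ (suc (l + i + j)) b             ≡⟨ cong (λ m → iter γ (suc m) b) (+-assoc l i j) ⟩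
        iter γ (suc l + (i + j)) b             ≡⟨ iter-+ γ (suc l) (i + j) b ⟩
        iter γ (suc l) (iter γ (i + j) b)      ≡⟨ cong (iter γ (suc l)) (trans (iter-+ γ i j b) eq) ⟩
        iter γ (suc l) b                       ∎
        where open ≡-Reasoning

  module _ {a b : Fin n} (a∈E : inᵇ a E ≡ true) (b∈E : inᵇ b E ≡ true) (a≢b : a ≢ b) where

    private
      ≢a : ∀ {f c} → LabelFree E f c → c ≢ a
      ≢a lf = labelFree-∉ E a∈E lf 0
      ≢b : ∀ {f c} → LabelFree E f c → c ≢ b
      ≢b lf = labelFree-∉ E b∈E lf 0

    first-meets : ∀ {γ c} → First a b γ c → Meets γ b c a
    first-meets {γ} {c} (k , refl , free , before) = k , refl ,
      (λ j j<k eq → proj₁ (before j j<k) (subst (Free γ) (sym eq) free)) ,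
      λ j j≤k → avoid j (m≤n⇒m<n∨m≡n j≤k)
      where
      avoid : ∀ j → j < k ⊎ j ≡ k → iter γ j b ≢ a
      avoid j (inj₁ j<k)  = proj₂ (before j j<k)
      avoid j (inj₂ refl) = ≢a free

    first-rotate : ∀ {γ c} → Transitive γ → First a b γ c →
      Transitive (rotate a b c γ) × Rotated a b c γ (rotate a b c γ)
    first-rotate {γ} {c} tr first@(_ , _ , free , _) =
      rotated-transitive tr r (first-meets first) a≢b (≢b free ∘ sym) (≢a free) , r
      where
      r : Rotated a b c γ (rotate a b c γ)
      r = rotate-rotated a b c γ a≢b (≢b free ∘ sym) (≢a free)

    -- The cycle of c₂ under D ∘ γ₂ is closed under D ∘ γ₁ ∘ (a b c₂), which
    -- therefore has one more label-free cycle than D ∘ γ₁.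
    no-second-split : ∀ {γ₁ γ₂ γ′ c₁ c₂} → Transitive γ₁ → cE E (D ∘ₚ γ₁) ≡ θ D E →
      First a b γ₁ c₁ → First a b γ₂ c₂ → Rotated a b c₁ γ₁ γ′ → Rotated a b c₂ γ₂ γ′ →
      c₁ ≢ c₂ → ¬ Reaches (D ∘ₚ γ₂) c₂ c₁
    no-second-split {γ₁} {γ₂} {γ′} {c₁} {c₂} tr₁ max₁ (_ , _ , free₁ , _) (k , refl , free₂ , before)
      r₁ r₂ c₁≢c₂ c₂⇝c₁ = <-irrefl refl (≤-trans (≤-reflexive (cong suc (sym max₁)))
        (≤-trans (≤-reflexive (sym more)) (cE≤θ tr″)))
      where
      α₂ γ″ α″ : Fin n → Fin n
      α₂ = D ∘ₚ γ₂
      γ″ = rotate a b c₂ γ₁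
      α″ = D ∘ₚ γ″

      r″ : Rotated a b c₂ γ₁ γ″
      r″ = rotate-rotated a b c₂ γ₁ a≢b (≢b free₂ ∘ sym) (≢a free₂)

      γ₁≡γ₂ : ∀ {z} → z ≢ a → z ≢ b → z ≢ c₁ → z ≢ c₂ → γ₁ z ≡ γ₂ z
      γ₁≡γ₂ z≢a z≢b z≢c₁ z≢c₂ = trans (sym (off r₁ z≢a z≢b z≢c₁)) (off r₂ z≢a z≢b z≢c₂)

      free-c₁ : Free γ₂ c₁
      free-c₁ = labelFree-reaches E c₂⇝c₁ free₂

      -- At `b` both maps take the value `γ′ a`. Elsewhere they could differ only at `a`, `c₁` or
      -- `c₂`; the path has not met `a`, and both `c₁` and `c₂` are label free under `γ₂`, unlike
      -- the points before time `k`.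
      agree : ∀ j → j ≤ k → iter γ₁ j b ≡ iter γ₂ j b
      agree zero    _   = refl
      agree (suc j) j<k = trans (cong γ₁ (agree j (<⇒≤ j<k))) step
        where
        labelled : ¬ Free γ₂ (iter γ₂ j b)
        labelled = proj₁ (before j j<k)
        step : γ₁ (iter γ₂ j b) ≡ γ₂ (iter γ₂ j b)
        step with iter γ₂ j b ≟ b
        ... | yes eq = trans (cong γ₁ eq)
          (trans (sym (at-a r₁)) (trans (at-a r₂) (cong γ₂ (sym eq))))
        ... | no z≢b = γ₁≡γ₂ (proj₂ (before j j<k)) z≢b
          (λ eq → labelled (subst (Free γ₂) (sym eq) free-c₁))
          (λ eq → labelled (subst (Free γ₂) (sym eq) free₂))

      meets : Meets γ₁ b c₂ a
      meets with _ , min , avoid ← proj₂ (first-meets {γ₂} (k , refl , free₂ , before)) =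
        k , agree k ≤-refl ,
        (λ j j<k → min j j<k ∘ trans (sym (agree j (<⇒≤ j<k)))) ,
        (λ j j≤k → avoid j j≤k ∘ trans (sym (agree j j≤k)))

      tr″ : Transitive γ″
      tr″ = rotated-transitive tr₁ r″ meets a≢b (≢b free₂ ∘ sym) (≢a free₂)

      -- On the `α₂`-cycle of `c₂`, the map `α″` is `α₂` with the images of `c₁` and `c₂` exchanged.
      stays : ∀ j → Reaches α₂ c₂ (iter α″ j c₂)
      stays zero = 0 , refl
      stays (suc j) = closed (_ ≟ c₂) (_ ≟ c₁) (stays j)
        where
        closed : ∀ {w} → Dec (w ≡ c₂) → Dec (w ≡ c₁) → Reaches α₂ c₂ w → Reaches α₂ c₂ (α″ w)
        closed (yes refl) _ _ = subst (Reaches α₂ c₂)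
          (cong (D ⟨$⟩ʳ_) (trans (sym (off r₂ (≢a free-c₁) (≢b free-c₁) c₁≢c₂)) (trans (at-c r₁) (sym (at-c r″)))))
          (reaches-step {f = α₂} c₂⇝c₁)
        closed (no _) (yes refl) _ = 1 ,
          cong (D ⟨$⟩ʳ_) (trans (sym (at-b r₂)) (trans (at-b r₁) (sym (off r″ (≢a free-c₁) (≢b free-c₁) c₁≢c₂))))
        closed {w} (no w≢c₂) (no w≢c₁) c₂⇝w = subst (Reaches α₂ c₂)
          (cong (D ⟨$⟩ʳ_) (trans (sym (γ₁≡γ₂ w≢a w≢b w≢c₁ w≢c₂)) (sym (off r″ w≢a w≢b w≢c₂))))
          (reaches-step {f = α₂} c₂⇝w)
          where
          w≢a : w ≢ a
          w≢a = ≢a (labelFree-reaches E c₂⇝w free₂)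
          w≢b : w ≢ b
          w≢b = ≢b (labelFree-reaches E c₂⇝w free₂)

      -- Read backwards: `γ₁` is `γ″` followed on the right by `(b a c₂)`, which merges the
      -- label-free `α″`-cycle of `c₂` into labelled ones.
      more : cE E α″ ≡ suc (cE E (D ∘ₚ γ₁))
      more = cE-rotated E (∘ₚ-injective tr″) b∈E a∈E
        (λ j → labelFree-reaches E (stays j) free₂ 0)
        (rotated-∘ (D ⟨$⟩ʳ_) (rotated-inverse r″))

    -- The cycles of c₁ and c₂ run in parallel from the common image of b under D ∘ γ′.
    one-reaches-other : ∀ {γ₁ γ₂ γ′ c₁ c₂} → Transitive γ₁ → Free γ₁ c₁ → Free γ₂ c₂ →
      Rotated a b c₁ γ₁ γ′ → Rotated a b c₂ γ₂ γ′ →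
      Reaches (D ∘ₚ γ₂) c₂ c₁ ⊎ Reaches (D ∘ₚ γ₁) c₁ c₂
    one-reaches-other {γ₁} {γ₂} {γ′} {c₁} {c₂} tr₁ free₁ free₂ r₁ r₂ =
      let k , eq = unstep α₁ (∘ₚ-injective tr₁) c₁ in go k (1 , refl) (1 , sym w≡) eq
      where
      α₁ α₂ : Fin n → Fin n
      α₁ = D ∘ₚ γ₁
      α₂ = D ∘ₚ γ₂
      w≡ : α₁ c₁ ≡ α₂ c₂
      w≡ = cong (D ⟨$⟩ʳ_) (trans (sym (at-b r₁)) (at-b r₂))
      go : ∀ k {z} → Reaches α₁ c₁ z → Reaches α₂ c₂ z → iter α₁ k z ≡ c₁ →
        Reaches α₂ c₂ c₁ ⊎ Reaches α₁ c₁ c₂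
      go zero    _    c₂⇝z refl = inj₁ c₂⇝z
      go (suc k) {z} c₁⇝z c₂⇝z eq with z ≟ c₁ | z ≟ c₂
      ... | yes refl | _ = inj₁ c₂⇝z
      ... | no _ | yes refl = inj₂ c₁⇝z
      ... | no z≢c₁ | no z≢c₂ = go k (reaches-step {f = α₁} c₁⇝z)
        (subst (Reaches α₂ c₂) (cong (D ⟨$⟩ʳ_) (trans (sym (off r₂ z≢a z≢b z≢c₂)) (off r₁ z≢a z≢b z≢c₁)))
          (reaches-step {f = α₂} c₂⇝z))
        (trans (iter-shift α₁ k z) eq)
        where
        z≢a : z ≢ a
        z≢a = ≢a (labelFree-reaches E c₁⇝z free₁)
        z≢b : z ≢ b
        z≢b = ≢b (labelFree-reaches E c₁⇝z free₁)

    -- For equal `c₁` and `c₂` the 3-cycle is simply inverted. Otherwise the maximality of `γ₁` or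
    -- of `γ₂` is contradicted, according to which element lies in the cycle of the other.
    drop-injective : ∀ {γ₁ γ₂ γ′} → Drop a b γ₁ γ′ → Drop a b γ₂ γ′ → γ₁ ≗ γ₂
    drop-injective (tr₁ , max₁ , c₁ , first₁ , r₁) (tr₂ , max₂ , c₂ , first₂ , r₂) with c₁ ≟ c₂
    ... | yes refl = rotated-unique (rotated-inverse r₁) (rotated-inverse r₂)
    ... | no c₁≢c₂ with one-reaches-other tr₁ (proj₁ (proj₂ (proj₂ first₁))) (proj₁ (proj₂ (proj₂ first₂))) r₁ r₂
    ... | inj₁ c₂⇝c₁ = ⊥-elim (no-second-split tr₁ max₁ first₁ first₂ r₁ r₂ c₁≢c₂ c₂⇝c₁)
    ... | inj₂ c₁⇝c₂ = ⊥-elim (no-second-split tr₂ max₂ first₂ first₁ r₂ r₁ (c₁≢c₂ ∘ sym) c₁⇝c₂)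

  -- Reduces both alternatives of `Hyp` to one moved point with image outside `E`. In the second,
  -- walking back along the orbit from a point outside `E` finds a step that leaves `E`; such a step
  -- cannot be a fixed point.
  boundary : Hyp D E → ∃ λ y → inᵇ (D ⟨$⟩ʳ y) E ≡ false × D ⟨$⟩ʳ y ≢ y
  boundary (inj₁ (x , Dx≢x , free)) = x , ¬-not (free 1 ∘ lookup⇒[]= _ E) , Dx≢x
  boundary (inj₂ (x , x∈E , k , ∉E)) = go k (¬-not (∉E ∘ lookup⇒[]= _ E))
    where
    go : ∀ k → inᵇ (iter (D ⟨$⟩ʳ_) k x) E ≡ false → ∃ λ y → inᵇ (D ⟨$⟩ʳ y) E ≡ false × D ⟨$⟩ʳ y ≢ y
    go zero ∉E with () ← trans (sym ([]=⇒lookup x∈E)) ∉E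
    go (suc k) ∉E with inᵇ (iter (D ⟨$⟩ʳ_) k x) E in eq
    ... | false = go k eq
    ... | true  = iter (D ⟨$⟩ʳ_) k x , ∉E , λ fixed → contradiction
      (trans (sym eq) (trans (cong (λ z → inᵇ z E) (sym fixed)) ∉E)) λ ()

  θ>0 : Hyp D E → 0 < θ D E
  θ>0 hyp with y , ∉E , Dy≢y ← boundary hyp
    with g , tr , gc≡y ← transitive-through Dy≢y =
    ≤-trans (isRep⇒cE>0 E {x = D ⟨$⟩ʳ y}
      ((λ k → trans (cong (λ z → inᵇ z E) (stays k)) ∉E) ,
       (λ k → ≤-reflexive (cong toℕ (sym (stays k))))))
      (cE≤θ tr)
    where
    stays : ∀ k → iter (D ∘ₚ g) k (D ⟨$⟩ʳ y) ≡ D ⟨$⟩ʳ y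
    stays = iter-fixed (cong (D ⟨$⟩ʳ_) gc≡y)

  -- Counting maximisers against their images

  private
    Maxima Nexts : List (Fin n → Fin n)
    Maxima = filterᵇ (λ γ → ⌊ cE E (D ∘ₚ γ) ℕ.≟ θ D E ⌋) (cyclicPerms n)
    Nexts  = filterᵇ (λ γ → ⌊ suc (cE E (D ∘ₚ γ)) ℕ.≟ θ D E ⌋) (cyclicPerms n)

  drop-exists : ∀ {a b γ c} → inᵇ a E ≡ true → inᵇ b E ≡ true → a ≢ b →
    Transitive γ → cE E (D ∘ₚ γ) ≡ θ D E → First a b γ c → Any (Drop a b γ) Nexts
  drop-exists {a} {b} {γ} {c} a∈E b∈E a≢b tr max first
    with tr′ , r ← first-rotate a∈E b∈E a≢b tr first
    with γ′ , γ′∈ , eq ← cyclicPerms-complete tr′ =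
    lose (∈-filterᵇ⁺ γ′∈ (T⇒≡true (fromWitness (trans (sym fewer) max))))
      (tr , max , c , first , r′)
    where
    r′ : Rotated a b c γ γ′
    r′ = rotated-respʳ eq r
    fewer : cE E (D ∘ₚ γ) ≡ suc (cE E (D ∘ₚ γ′))
    fewer = cE-rotated E (∘ₚ-injective tr) a∈E b∈E (proj₁ (proj₂ (proj₂ first)))
      (rotated-∘ (D ⟨$⟩ʳ_) r′)

  -- The factor 2 comes from the two orders of the labels: each has its own tagged copy of `Nexts`,
  -- every maximiser is related to an entry of some copy, and within either copy the relation is
  -- injective.
  countMax≤2*countMaxMinus1 : 1 < ∣ E ∣ → Hyp D E → countMax D E ≤ 2 * countMaxMinus1 D E
  countMax≤2*countMaxMinus1 lt hyp with a , b , a∈E , b∈E , a≢b ← two-members E lt = begin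
    length Maxima                                       ≤⟨ length-≤ _≗_ {R} (λ {_} {_} {y} → R-injective {y = y}) distinct related ⟩
    length (map inj₁ Nexts ++ map inj₂ Nexts)           ≡⟨ length-++ (map inj₁ Nexts) ⟩
    length (map inj₁ Nexts) + length (map inj₂ Nexts)   ≡⟨ cong₂ _+_ (length-map inj₁ Nexts) (length-map inj₂ Nexts) ⟩
    length Nexts + length Nexts                         ≡⟨ cong (length Nexts +_) (+-identityʳ _) ⟨
    2 * length Nexts                                    ∎
    where
    open ≤-Reasoning
    R : (Fin n → Fin n) → (Fin n → Fin n) ⊎ (Fin n → Fin n) → Set
    R γ (inj₁ γ′) = Drop a b γ γ′
    R γ (inj₂ γ′) = Drop b a γ γ′

    R-injective : ∀ {γ₁ γ₂ y} → R γ₁ y → R γ₂ y → γ₁ ≗ γ₂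
    R-injective {y = inj₁ _} = drop-injective a∈E b∈E a≢b
    R-injective {y = inj₂ _} = drop-injective b∈E a∈E (a≢b ∘ sym)

    distinct : AllPairs (λ f g → ¬ f ≗ g) Maxima
    distinct = AllPairs.filter⁺ _ (AllPairs.filter⁺ _ (allFuns-unique n n))

    related : All (λ γ → Any (R γ) (map inj₁ Nexts ++ map inj₂ Nexts)) Maxima
    related = All.tabulate λ γ∈ → relate (∈-filterᵇ⁻ {xs = cyclicPerms n} γ∈)
      where
      relate : ∀ {γ} → γ ∈ₗ cyclicPerms n × ⌊ cE E (D ∘ₚ γ) ℕ.≟ θ D E ⌋ ≡ true →
        Any (R γ) (map inj₁ Nexts ++ map inj₂ Nexts)
      relate {γ} (γ∈ , eq)
        with max ← toWitness {a? = cE E (D ∘ₚ γ) ℕ.≟ θ D E} (≡true⇒T eq)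
        with tr ← cyclicPerms-transitive γ∈
        -- Positivity of the maximum ensures that the search for a label-free cycle ends.
        with c , free ← cE>0⇒labelFree E (subst (0 <_) (sym max) (θ>0 hyp))
        with first-exists tr a≢b free
      ... | inj₁ (_ , first) = Any.++⁺ˡ (Any.map⁺ (drop-exists a∈E b∈E a≢b tr max first))
      ... | inj₂ (_ , first) = Any.++⁺ʳ (map inj₁ Nexts)
        (Any.map⁺ (drop-exists b∈E a∈E (a≢b ∘ sym) tr max first))

-- An example with equality

swap₂₃ : Permutation′ 4
swap₂₃ = transpose 2F 3F

first-two : Subset 4
first-two = inside ∷ inside ∷ outside ∷ outside ∷ []

swap₂₃-hyp : Hyp swap₂₃ first-two
swap₂₃-hyp = inj₁ (2F , (λ ()) , λ k k∈E → outside≢inside (orbit k) ([]=⇒lookup k∈E))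
  where
  orbit : ∀ k → iter (swap₂₃ ⟨$⟩ʳ_) k 2F ≡ 2F ⊎ iter (swap₂₃ ⟨$⟩ʳ_) k 2F ≡ 3F
  orbit zero = inj₁ refl
  orbit (suc k) with orbit k
  ... | inj₁ eq = inj₂ (cong (swap₂₃ ⟨$⟩ʳ_) eq)
  ... | inj₂ eq = inj₁ (cong (swap₂₃ ⟨$⟩ʳ_) eq)
  outside≢inside : ∀ {z} → z ≡ 2F ⊎ z ≡ 3F → inᵇ z first-two ≢ true
  outside≢inside (inj₁ refl) ()
  outside≢inside (inj₂ refl) ()

theorem1 : (∀ (n : ℕ) (D : Permutation′ n) (E : Subset n) →
    1 ≤ n → 1 < ∣ E ∣ → Hyp D E →
    countMax D E ≤ 2 * countMaxMinus1 D E)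
    ×
    (Σ ℕ λ n → Σ (Permutation′ n) λ D → Σ (Subset n) λ E →
    1 ≤ n × 1 < ∣ E ∣ × Hyp D E ×
    countMax D E ≡ 2 * countMaxMinus1 D E)
theorem1 = (λ n D E _ → countMax≤2*countMaxMinus1 D E) ,
  -- Composing with the transposition of 2 and 3 cuts a 4-cycle into two cycles. One of them is
  -- label free exactly when 2 and 3 are adjacent in the 4-cycle, which holds for four of the six;
  -- the other two leave none. So the maximum is 1, and `refl` evaluates the counts 4 and 2.
  4 , swap₂₃ , first-two , s≤s z≤n , s≤s (s≤s z≤n) , swap₂₃-hyp , refl
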